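{- Let $p$ be a prime with $p\equiv 3 \pmod 4$ and let $\mathbb{F}_p$ be the field with $p$ elements. For $K\in\mathbb{F}_p$ let $C_K=\{(u,v)\in\mathbb{F}_p^2 : u^2+v^2=K\}$ be the circle with center $(0,0)$ and quadrance $K$ (so $|C_0|=1$ and $|C_i|=p+1$ for $i\neq 0$). For $i,j,k\in\mathbb{F}_p$ let $$N_{ij}^k=\#\{(a,b)\in C_i\times C_j : a+b\in C_k\},\qquad n_{ij}^k=\frac{N_{ij}^k}{|C_i|\,|C_j|}.$$ Let $i,j\in\mathbb{F}_p$ be nonzero, let $k\in\mathbb{F}_p$, and put $V=ij-\frac{(k-i-j)^2}{4}$. Then: (i) if $V$ is not a square in $\mathbb{F}_p$, then $N_{ij}^k=0$ and $n_{ij}^k=0$; (ii) if $V=0$, then $N_{ij}^k=|C_i|=p+1$ and $n_{ij}^k=\frac{1}{p+1}$; (iii) otherwise (i.e. $V$ is a nonzero square), $N_{ij}^k=2|C_i|=2(p+1)$ and $n_{ij}^k=\frac{2}{p+1}$.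
   Context: Addition of points in $\mathbb{F}_p^2$ is coordinatewise. $N_{ij}^k$ counts the ways of reaching a point of $C_k$ from the origin by first translating by an element of $C_i$ and then by an element of $C_j$. -}

module Defs where

open import Data.Nat as ℕ using (ℕ; zero; suc; NonZero; _∸_)
open import Data.Nat.DivMod using (_mod_)
open import Data.Fin using (Fin; toℕ)
open import Data.List using (List; map; allFin)
open import Data.Nat.ListAction using (sum)
open import Data.Product using (_×_; _,_)
open import Data.Bool using (Bool; true; false)
open import Relation.Nullary using (Dec; does)
open import Data.Fin.Properties using (_≟_)
open import Data.Integer using (+_)
open import Data.Rational using (ℚ; 0ℚ; _/_)

module Fp (p : ℕ) .{{_ : NonZero p}} where

  F : Set
  F = Fin p

  fromℕ : ℕ → F
  fromℕ n = n mod p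

  _+F_ : F → F → F
  a +F b = fromℕ (toℕ a ℕ.+ toℕ b)

  _*F_ : F → F → F
  a *F b = fromℕ (toℕ a ℕ.* toℕ b)

  -F_ : F → F
  -F a = fromℕ (p ∸ toℕ a)

  _-F_ : F → F → F
  a -F b = a +F (-F b)

  0F : F
  0F = fromℕ 0

  _^F_ : F → ℕ → F
  a ^F zero = fromℕ 1
  a ^F suc n = a *F (a ^F n)

  -- multiplicative inverse in F_p (Fermat: a⁻¹ = a^(p-2); for p prime and a ≠ 0)
  invF : F → F
  invF a = a ^F (p ∸ 2)

  IsSquare : F → Set
  IsSquare x = Data.Product.∃ λ y → y *F y Relation.Binary.PropositionalEquality.≡ x
    where import Relation.Binary.PropositionalEquality

  Pt : Set
  Pt = F × F

  _+P_ : Pt → Pt → Pt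
  (a₁ , a₂) +P (b₁ , b₂) = (a₁ +F b₁ , a₂ +F b₂)

  Q : Pt → F
  Q (u , v) = (u *F u) +F (v *F v)

  inC : F → Pt → Bool
  inC K x = does (Q x ≟ K)

  allPts : List Pt
  allPts = Data.List.concatMap (λ u → map (u ,_) (allFin p)) (allFin p)

  [_] : Bool → ℕ
  [ true ] = 1
  [ false ] = 0

  card : F → ℕ
  card K = sum (map (λ x → [ inC K x ]) allPts)

  N : F → F → F → ℕ
  N i j k = sum (map (λ a → sum (map (λ b →
              [ inC i a Data.Bool.∧ inC j b Data.Bool.∧ inC k (a +P b) ]) allPts)) allPts)

  -- n_{ij}^k = N_{ij}^k / (|C_i| |C_j|)  (the denominator is never 0 for i, j ≠ 0;
  -- the value 0 in the degenerate case is a dummy convention)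
  n : F → F → F → ℚ
  n i j k with card i ℕ.* card j
  ... | zero = 0ℚ
  ... | suc m = (+ N i j k) / suc m

{-# OPTIONS --safe #-}

-- Identify 𝔽ₚ² with the ring 𝔽ₚ[√-1], so that Q is the norm: multiplication by a point z scales Q by Q z
-- and is injective when Q z ≠ 0.  Since p ≡ 3 (mod 4), Q vanishes only at the origin, so |C₀| = 1; by
-- pigeonhole Q is onto, hence multiplication by a point of norm K maps C₁ onto C_K, and all |C_K| with
-- K ≠ 0 equal some c with p² = 1 + (p - 1) c, i.e. c = p + 1.  For a ∈ C_i, the substitution w = ā b turns
-- b ∈ C_j, a + b ∈ C_k into w₁ = (k - i - j)/2, w₂² = V.  Hence N = |C_i| · #{y : y² = V}.
module Submission where

open import Defs
open import Data.Nat using (ℕ; zero; suc; NonZero; _%_)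
open import Data.Nat.Primality using (Prime; euclidsLemma; prime⇒nonTrivial)
open import Data.Integer using (+_)
open import Data.Rational using (_/_)
open import Data.Product using (_×_; _,_; ∃; proj₁; proj₂)
open import Relation.Binary.PropositionalEquality using (_≡_; _≢_)
open import Relation.Nullary using (¬_; yes; no; Dec; does)
open import Algebra.Bundles using (CommutativeRing; CommutativeMonoid)
open import Algebra.Solver.Ring.AlmostCommutativeRing using (fromCommutativeRing; _-Raw-AlmostCommutative⟶_)
open import Algebra.Structures using (IsCommutativeRing)
open import Data.Bool.Base using (true; false; _∧_)
open import Data.Empty using (⊥-elim)
open import Data.Fin.Base as Fin using (Fin; toℕ; splitAt; join)
open import Data.Fin.Properties as Finₚ using (_≟_; toℕ-fromℕ<; fromℕ<-cong; toℕ-injective; toℕ<n; toℕ≤pred[n]; pigeonhole; join-splitAt)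
open import Data.Integer.Base as ℤ using (ℤ; -[1+_]; _⊖_)
import Data.Integer.Properties as ℤₚ
open import Data.List.Base using (List; []; _∷_; _++_; map; length; foldr; concatMap; cartesianProduct; allFin)
open import Data.List.Membership.Propositional using (_∈_)
open import Data.List.Membership.Propositional.Properties using (∈-∃++; ∈-allFin; ∈-cartesianProduct⁺)
open import Data.List.Properties using (length-map; length-tabulate; map-∘)
open import Data.List.Relation.Binary.Permutation.Propositional using (_↭_; ↭-refl; ↭-trans; ↭-sym; ↭-prep; ↭⇒↭ₛ′)
open import Data.List.Relation.Binary.Permutation.Propositional.Properties using (shift; ↭-length; map⁺; ∈-resp-↭)
import Data.List.Relation.Binary.Permutation.Setoid.Properties as ↭ₛ
open import Data.List.Relation.Unary.All as All using (All; []; _∷_)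
open import Data.List.Relation.Unary.AllPairs using ([]; _∷_)
open import Data.List.Relation.Unary.Any using (here; there)
open import Data.List.Relation.Unary.Unique.Propositional using (Unique)
import Data.List.Relation.Unary.Unique.Propositional.Properties as Uniq
import Data.Maybe.Base as Maybe
open import Data.Nat.Base as ℕ using (_∸_)
open import Data.Nat.DivMod using (m<n⇒m%n≡m; %-distribˡ-+; %-distribˡ-*; m≡m%n+[m/n]*n; n%n≡0)
open import Data.Nat.Divisibility using (_∣_; m%n≡0⇒n∣m; n∣m⇒m%n≡0; ∣⇒≤)
import Data.Nat.Properties as ℕₚ
import Data.Nat.Solver as ℕSolver
import Data.Rational.Properties as ℚₚ
import Data.Rational.Unnormalised.Base as ℚᵘ
open import Data.Sum as Sum using (_⊎_; inj₁; inj₂; [_,_]′)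
open import Function.Base using (_∘_; id)
open import Function.Bundles using (mk⇔)
open import Level using (0ℓ)
open import Relation.Binary.Consequences using (dec⇒weaklyDec)
import Relation.Binary.PropositionalEquality as ≡
open import Relation.Nullary.Decidable using (dec-true; dec-false; does-⇔; _×-dec_)

-- The conditions on w come from two expansions: Q(a + b) = i + j + 2 w₁ fixes w₁, and Q(w) = ij
-- leaves w₂² = ij - w₁². In the other direction these equations only return i Q(b) = ij, and
-- dividing by i ≠ 0 gives Q(b) = j. That Q vanishes only at the origin is a consequence of Fermat's
-- theorem alone: with p = 3 + 4q, every nonzero u equals u³ (u⁴)^q, and u² = -v² makes the fourth
-- powers of u and v agree. Fermat's theorem is also what makes the inverses work, including the 1/4
-- in V, because they are defined as powers a^(p-2). Circles are never listed. Every count is a sum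
-- of 0/1 indicators over the whole plane, and a bijection between circles becomes an injective
-- change of variable in that sum, so no inverse map has to be written down.

module IntegerCoefficients {c ℓ} (R : CommutativeRing c ℓ) where
  open CommutativeRing R
  open import Algebra.Properties.Ring ring
  open import Algebra.Properties.Group +-group using (ε⁻¹≈ε; ⁻¹-involutive)
  open import Algebra.Properties.AbelianGroup +-abelianGroup using (⁻¹-∙-comm)
  open import Algebra.Properties.Semiring.Mult.TCOptimised semiring renaming (_×_ to _×′_)
  open import Relation.Binary.Reasoning.Setoid setoid

  -- With the type-checking optimised multiple, fromℤ (+ 1) is 1# and fromℤ (+ 2) is 1# + 1# definitionally.
  fromℤ : ℤ → Carrier
  fromℤ (+ n)    = n ×′ 1#
  fromℤ -[1+ n ] = - (suc n ×′ 1#)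

  [x+y]-[x+z]≈y-z : ∀ x y z → (x + y) - (x + z) ≈ y - z
  [x+y]-[x+z]≈y-z x y z = begin
    (x + y) - (x + z)      ≈⟨ +-congˡ (⁻¹-∙-comm x z) ⟨
    (x + y) + (- x + - z)  ≈⟨ +-congʳ (+-comm x y) ⟩
    (y + x) + (- x + - z)  ≈⟨ +-assoc y x _ ⟩
    y + (x + (- x + - z))  ≈⟨ +-congˡ (+-assoc x (- x) (- z)) ⟨
    y + ((x - x) + - z)    ≈⟨ +-congˡ (+-congʳ (-‿inverseʳ x)) ⟩
    y + (0# + - z)         ≈⟨ +-congˡ (+-identityˡ _) ⟩
    y - z                  ∎

  fromℤ-⊖ : ∀ m n → fromℤ (m ⊖ n) ≈ m ×′ 1# - n ×′ 1#
  fromℤ-⊖ m zero = begin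
    m ×′ 1#       ≈⟨ +-identityʳ _ ⟨
    m ×′ 1# + 0#  ≈⟨ +-congˡ ε⁻¹≈ε ⟨
    m ×′ 1# - 0#  ∎
  fromℤ-⊖ zero (suc n) = sym (+-identityˡ _)
  fromℤ-⊖ (suc m) (suc n) = begin
    fromℤ (suc m ⊖ suc n)     ≡⟨ ≡.cong fromℤ (ℤₚ.[1+m]⊖[1+n]≡m⊖n m n) ⟩
    fromℤ (m ⊖ n)             ≈⟨ fromℤ-⊖ m n ⟩
    m ×′ 1# - n ×′ 1#         ≈⟨ [x+y]-[x+z]≈y-z 1# _ _ ⟨
    (1# + m ×′ 1#) - (1# + n ×′ 1#)
                              ≈⟨ +-cong (1+× m 1#) (-‿cong (1+× n 1#)) ⟨
    suc m ×′ 1# - suc n ×′ 1# ∎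

  fromℤ-+ : ∀ i j → fromℤ (i ℤ.+ j) ≈ fromℤ i + fromℤ j
  fromℤ-+ (+ m)    (+ n)    = ×-homo-+ 1# m n
  fromℤ-+ (+ m)    -[1+ n ] = fromℤ-⊖ m (suc n)
  fromℤ-+ -[1+ m ] (+ n)    = trans (fromℤ-⊖ n (suc m)) (+-comm _ _)
  fromℤ-+ -[1+ m ] -[1+ n ] = begin
    - ((2 ℕ.+ (m ℕ.+ n)) ×′ 1#)         ≡⟨ ≡.cong (λ k → - (suc k ×′ 1#)) (ℕₚ.+-suc m n) ⟨
    - ((suc m ℕ.+ suc n) ×′ 1#)         ≈⟨ -‿cong (×-homo-+ 1# (suc m) (suc n)) ⟩
    - (suc m ×′ 1# + suc n ×′ 1#)       ≈⟨ ⁻¹-∙-comm _ _ ⟨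
    - (suc m ×′ 1#) + - (suc n ×′ 1#)   ∎

  fromℤ-neg : ∀ i → fromℤ (ℤ.- i) ≈ - fromℤ i
  fromℤ-neg (+ zero)  = sym ε⁻¹≈ε
  fromℤ-neg (+ suc n) = refl
  fromℤ-neg -[1+ n ]  = sym (⁻¹-involutive _)

  fromℤ-*-+ : ∀ m j → fromℤ (+ m ℤ.* j) ≈ m ×′ 1# * fromℤ j
  fromℤ-*-+ m (+ n) = begin
    fromℤ (+ m ℤ.* + n)      ≡⟨ ≡.cong fromℤ (ℤₚ.pos-* m n) ⟨
    (m ℕ.* n) ×′ 1#          ≈⟨ ×1-homo-* m n ⟩
    m ×′ 1# * n ×′ 1#        ∎
  fromℤ-*-+ m -[1+ n ] = begin
    fromℤ (+ m ℤ.* ℤ.- (+ suc n))      ≡⟨ ≡.cong fromℤ (ℤₚ.neg-distribʳ-* (+ m) (+ suc n)) ⟨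
    fromℤ (ℤ.- (+ m ℤ.* + suc n))      ≈⟨ fromℤ-neg (+ m ℤ.* + suc n) ⟩
    - fromℤ (+ m ℤ.* + suc n)          ≈⟨ -‿cong (fromℤ-*-+ m (+ suc n)) ⟩
    - (m ×′ 1# * suc n ×′ 1#)          ≈⟨ -‿distribʳ-* _ _ ⟩
    m ×′ 1# * - (suc n ×′ 1#)          ∎

  fromℤ-* : ∀ i j → fromℤ (i ℤ.* j) ≈ fromℤ i * fromℤ j
  fromℤ-* (+ m)    j = fromℤ-*-+ m j
  fromℤ-* -[1+ m ] j = begin
    fromℤ (ℤ.- (+ suc m) ℤ.* j)        ≡⟨ ≡.cong fromℤ (ℤₚ.neg-distribˡ-* (+ suc m) j) ⟨
    fromℤ (ℤ.- (+ suc m ℤ.* j))        ≈⟨ fromℤ-neg (+ suc m ℤ.* j) ⟩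
    - fromℤ (+ suc m ℤ.* j)            ≈⟨ -‿cong (fromℤ-*-+ (suc m) j) ⟩
    - (suc m ×′ 1# * fromℤ j)          ≈⟨ -‿distribˡ-* _ _ ⟩
    - (suc m ×′ 1#) * fromℤ j          ∎

  -- Integer coefficients have decidable equality, so the solver can cancel terms and use numerals
  -- in an arbitrary commutative ring.
  homomorphism : ℤ.+-*-rawRing -Raw-AlmostCommutative⟶ fromCommutativeRing R
  homomorphism = record
    { ⟦_⟧    = fromℤ
    ; +-homo = fromℤ-+
    ; *-homo = fromℤ-*
    ; -‿homo = fromℤ-neg
    ; 0-homo = refl
    ; 1-homo = refl
    }

  open import Algebra.Solver.Ring ℤ.+-*-rawRing (fromCommutativeRing R) homomorphism
    (λ i j → Maybe.map (λ e → reflexive (≡.cong fromℤ e)) (dec⇒weaklyDec ℤₚ._≟_ i j)) public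

  -- Proof by certificate: nested uses leave one polynomial identity for the solver, in which each
  -- hypothesis `l ≈ r` appears as `e * (l - r)`. The summands stand in the order of the hypotheses
  -- from the outermost inwards, and each `e` is read off from the identity.
  linear-combination : ∀ {x y l r e} → l ≈ r → x ≈ y + e * (l - r) → x ≈ y
  linear-combination {x} {y} {l} {r} {e} l≈r eq = begin
    x                ≈⟨ eq ⟩
    y + e * (l - r)  ≈⟨ +-congˡ (*-congˡ (trans (+-congʳ l≈r) (-‿inverseʳ r))) ⟩
    y + e * 0#       ≈⟨ +-congˡ (zeroʳ e) ⟩
    y + 0#           ≈⟨ +-identityʳ y ⟩
    y                ∎

-- Polynomial identities in a commutative ring

module RingIdentities {c ℓ} (R : CommutativeRing c ℓ) where
  open CommutativeRing R
  open IntegerCoefficients R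

  x⁴[x³y]≈x³[x⁴y] : ∀ a x → a * (a * (a * (a * ((a * (a * a)) * x)))) ≈ (a * (a * a)) * (((a * a) * (a * a)) * x)
  x⁴[x³y]≈x³[x⁴y] = solve 2 (λ a x → a :* (a :* (a :* (a :* ((a :* (a :* a)) :* x)))) :=
    (a :* (a :* a)) :* (((a :* a) :* (a :* a)) :* x)) refl

  xy≈xz⇒x[y-z]≈0 : ∀ x y z → x * y ≈ x * z → x * (y - z) ≈ 0#
  xy≈xz⇒x[y-z]≈0 x y z eq = linear-combination eq
    (solve 3 (λ x y z → x :* (y :- z) := con (+ 0) :+ con (+ 1) :* (x :* y :- x :* z)) refl x y z)

  x²≈y²⇒[x-y][x+y]≈0 : ∀ x y → x * x ≈ y * y → (x - y) * (x + y) ≈ 0#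
  x²≈y²⇒[x-y][x+y]≈0 x y eq = linear-combination eq
    (solve 2 (λ x y → (x :- y) :* (x :+ y) := con (+ 0) :+ con (+ 1) :* (x :* x :- y :* y)) refl x y)

  -- x⁴ - y⁴ has the factor x² + y². This supplies the common `X` of `cubes⇒2xy≈0`.
  x²+y²≈0⇒x⁴≈y⁴ : ∀ x y → x * x + y * y ≈ 0# → (x * x) * (x * x) ≈ (y * y) * (y * y)
  x²+y²≈0⇒x⁴≈y⁴ x y eq = linear-combination eq
    (solve 2 (λ x y → (x :* x) :* (x :* x) := (y :* y) :* (y :* y)
      :+ (x :* x :- y :* y) :* ((x :* x :+ y :* y) :- con (+ 0))) refl x y)

  -- If x² = - y² and both x and y are fixed by z ↦ z³ X, then xy = x³Xy = - x(y³X) = - xy.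
  cubes⇒2xy≈0 : ∀ x y X → x * x + y * y ≈ 0# → (x * (x * x)) * X ≈ x → (y * (y * y)) * X ≈ y →
                (1# + 1#) * (x * y) ≈ 0#
  cubes⇒2xy≈0 x y X eq eqx eqy = linear-combination eq (linear-combination eqx (linear-combination eqy
    (solve 3 (λ x y X → con (+ 2) :* (x :* y) := ((con (+ 0)
      :+ (x :* y :* X) :* ((x :* x :+ y :* y) :- con (+ 0)))
      :+ (:- y) :* ((x :* (x :* x)) :* X :- x))
      :+ (:- x) :* ((y :* (y :* y)) :* X :- y)) refl x y X)))

  -- The Brahmagupta-Fibonacci identity.
  norm-* : ∀ a b c d → (a * c - b * d) * (a * c - b * d) + (a * d + b * c) * (a * d + b * c)
                       ≈ (a * a + b * b) * (c * c + d * d)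
  norm-* = solve 4 (λ a b c d →
    (a :* c :- b :* d) :* (a :* c :- b :* d) :+ (a :* d :+ b :* c) :* (a :* d :+ b :* c)
    := (a :* a :+ b :* b) :* (c :* c :+ d :* d)) refl

  -- The real part of N(z) x = z̄ (z x); with `conj-*-im` it recovers x from z x whenever N(z) can
  -- be cancelled.
  conj-*-re : ∀ a b c d → (a * a + b * b) * c ≈ a * (a * c - b * d) + b * (a * d + b * c)
  conj-*-re = solve 4 (λ a b c d → (a :* a :+ b :* b) :* c
    := a :* (a :* c :- b :* d) :+ b :* (a :* d :+ b :* c)) refl

  conj-*-im : ∀ a b c d → (a * a + b * b) * d ≈ a * (a * d + b * c) - b * (a * c - b * d)
  conj-*-im = solve 4 (λ a b c d → (a :* a :+ b :* b) :* d
    := a :* (a :* d :+ b :* c) :- b :* (a :* c :- b :* d)) refl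

  neg-square : ∀ x → (- x) * (- x) ≈ x * x
  neg-square = solve 1 (λ x → (:- x) :* (:- x) := x :* x) refl

  norm-conj : ∀ a b → a * a + (- b) * (- b) ≈ a * a + b * b
  norm-conj a b = +-congˡ (neg-square b)

  2x≈x+x : ∀ x → (1# + 1#) * x ≈ x + x
  2x≈x+x = solve 1 (λ x → con (+ 2) :* x := x :+ x) refl

  x≈y-z⇒x+z≈y : ∀ x y z → x ≈ y - z → x + z ≈ y
  x≈y-z⇒x+z≈y x y z eq = linear-combination eq
    (solve 3 (λ x y z → x :+ z := y :+ con (+ 1) :* (x :- (y :- z))) refl x y z)

  -- t is 1/4, so C is (k - i - j)/2; re c d and im c d are the coordinates of (a - b√-1)(c + d√-1).
  module CirclePair (i j k t a b : Carrier)
    (4t≈1 : ((1# + 1#) * (1# + 1#)) * t ≈ 1#)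
    (a²+b²≈i : a * a + b * b ≈ i) where

    re im : Carrier → Carrier → Carrier
    re c d = a * c - (- b) * d
    im c d = a * d + (- b) * c

    D : Carrier
    D = (k - i) - j

    V : Carrier
    V = i * j - (D * D) * t

    C : Carrier
    C = D * (t + t)

    -- The three norm equations combine to 2 `re` = `D`; their weights are ± 2t because 2t is 1/2.
    re≈C : ∀ c d → c * c + d * d ≈ j → (a + c) * (a + c) + (b + d) * (b + d) ≈ k → re c d ≈ C
    re≈C c d eqj eqk = linear-combination 4t≈1 (linear-combination a²+b²≈i
      (linear-combination eqj (linear-combination eqk
      (solve 8 (λ a b c d i j k t →
         a :* c :- (:- b) :* d :=
           ((k :- i) :- j) :* (t :+ t)
           :+ (:- (a :* c :+ b :* d)) :* ((con (+ 2) :* con (+ 2)) :* t :- con (+ 1))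
           :+ (:- (t :+ t)) :* ((a :* a :+ b :* b) :- i)
           :+ (:- (t :+ t)) :* ((c :* c :+ d :* d) :- j)
           :+ (t :+ t) :* (((a :+ c) :* (a :+ c) :+ (b :+ d) :* (b :+ d)) :- k))
         refl a b c d i j k t))))

    -- Norms multiply, so `re`² + `im`² = ij. The first certificate term turns `C`² = 4D²t² into the
    -- D²t of `V`.
    im²≈V : ∀ c d → c * c + d * d ≈ j → re c d ≈ C → im c d * im c d ≈ V
    im²≈V c d eqj eqC = linear-combination 4t≈1 (linear-combination a²+b²≈i
      (linear-combination eqj (linear-combination eqC
      (solve 8 (λ a b c d i j k t →
         let D = (k :- i) :- j ; C = D :* (t :+ t) ; re = a :* c :- (:- b) :* d ; im = a :* d :+ (:- b) :* c in
         im :* im :=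
           i :* j :- (D :* D) :* t
           :+ (:- (D :* D :* t)) :* ((con (+ 2) :* con (+ 2)) :* t :- con (+ 1))
           :+ (c :* c :+ d :* d) :* ((a :* a :+ b :* b) :- i)
           :+ i :* ((c :* c :+ d :* d) :- j)
           :+ (:- (re :+ C)) :* (re :- C))
         refl a b c d i j k t))))

    -- The factor i stays on both sides because a general ring has no cancellation; it is removed in
    -- `count-second`.
    i[c²+d²]≈ij : ∀ c d → re c d ≈ C → im c d * im c d ≈ V → i * (c * c + d * d) ≈ i * j
    i[c²+d²]≈ij c d eqC eqV = linear-combination 4t≈1 (linear-combination a²+b²≈i
      (linear-combination eqC (linear-combination eqV
      (solve 8 (λ a b c d i j k t →
         let D = (k :- i) :- j ; C = D :* (t :+ t) ; re = a :* c :- (:- b) :* d ; im = a :* d :+ (:- b) :* c in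
         i :* (c :* c :+ d :* d) :=
           i :* j
           :+ (D :* D :* t) :* ((con (+ 2) :* con (+ 2)) :* t :- con (+ 1))
           :+ (:- (c :* c :+ d :* d)) :* ((a :* a :+ b :* b) :- i)
           :+ (re :+ C) :* (re :- C)
           :+ con (+ 1) :* (im :* im :- (i :* j :- (D :* D) :* t)))
         refl a b c d i j k t))))

    norm-sum≈k : ∀ c d → c * c + d * d ≈ j → re c d ≈ C → (a + c) * (a + c) + (b + d) * (b + d) ≈ k
    norm-sum≈k c d eqj eqC = linear-combination 4t≈1 (linear-combination a²+b²≈i
      (linear-combination eqj (linear-combination eqC
      (solve 8 (λ a b c d i j k t →
         let D = (k :- i) :- j ; C = D :* (t :+ t) ; re = a :* c :- (:- b) :* d in
         (a :+ c) :* (a :+ c) :+ (b :+ d) :* (b :+ d) :=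
           k
           :+ D :* ((con (+ 2) :* con (+ 2)) :* t :- con (+ 1))
           :+ con (+ 1) :* ((a :* a :+ b :* b) :- i)
           :+ con (+ 1) :* ((c :* c :+ d :* d) :- j)
           :+ con (+ 2) :* (re :- C))
         refl a b c d i j k t))))

-- Permutations of lists and finite sums in commutative monoids

module _ {a} {A : Set a} where

  -- Cut the head of `xs` out of `ys`: as it does not recur in the tail, the tail lies in what
  -- remains, and the lengths stay equal.
  unique⊆⇒↭ : {xs ys : List A} → Unique xs → (∀ {x} → x ∈ xs → x ∈ ys) →
              length xs ≡ length ys → xs ↭ ys
  unique⊆⇒↭ {[]} {[]} _ _ _ = ↭-refl
  unique⊆⇒↭ {x ∷ xs} {ys} (x∉xs ∷ xs!) sub eq with ∈-∃++ (sub (here ≡.refl))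
  ... | as , bs , ≡.refl = ↭-trans (↭-prep x (unique⊆⇒↭ xs! sub′ eq′)) (↭-sym (shift x as bs))
    where
    eq′ : length xs ≡ length (as ++ bs)
    eq′ = ℕₚ.suc-injective (≡.trans eq (↭-length (shift x as bs)))
    sub′ : ∀ {y} → y ∈ xs → y ∈ as ++ bs
    sub′ y∈xs with ∈-resp-↭ (shift x as bs) (sub (there y∈xs))
    ... | here ≡.refl  = ⊥-elim (All.lookup x∉xs y∈xs ≡.refl)
    ... | there y∈     = y∈

module BigOperator {c ℓ} (M : CommutativeMonoid c ℓ) where
  open CommutativeMonoid M
  open import Algebra.Properties.CommutativeSemigroup commutativeSemigroup using (interchange)
  open import Relation.Binary.Reasoning.Setoid setoid

  -- Used for products in the field (Fermat's theorem) and for sums in ℕ, where it unfolds to the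
  -- `sum (map ...)` of `card` and `N`.
  ⨁ : ∀ {a} {A : Set a} → List A → (A → Carrier) → Carrier
  ⨁ xs f = foldr _∙_ ε (map f xs)

  module _ {a} {A : Set a} where

    ⨁-cong : ∀ (xs : List A) {f g} → (∀ x → f x ≈ g x) → ⨁ xs f ≈ ⨁ xs g
    ⨁-cong []       f≈g = refl
    ⨁-cong (x ∷ xs) f≈g = ∙-cong (f≈g x) (⨁-cong xs f≈g)

    ⨁-∙ : ∀ (xs : List A) f g → ⨁ xs (λ x → f x ∙ g x) ≈ ⨁ xs f ∙ ⨁ xs g
    ⨁-∙ []       f g = sym (identityˡ ε)
    ⨁-∙ (x ∷ xs) f g = trans (∙-congˡ (⨁-∙ xs f g)) (interchange _ _ _ _)

    ⨁-ε : ∀ (xs : List A) {f} → All (λ x → f x ≈ ε) xs → ⨁ xs f ≈ ε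
    ⨁-ε []       []        = refl
    ⨁-ε (x ∷ xs) (eq ∷ eqs) = trans (∙-cong eq (⨁-ε xs eqs)) (identityˡ ε)

    ⨁-single : ∀ {xs : List A} {x f} → Unique xs → x ∈ xs →
               (∀ {y} → y ≢ x → f y ≈ ε) → ⨁ xs f ≈ f x
    ⨁-single (x∉ ∷ _) (here ≡.refl) f≈ε =
      trans (∙-congˡ (⨁-ε _ (All.map (λ x≢y → f≈ε (λ e → x≢y (≡.sym e))) x∉))) (identityʳ _)
    ⨁-single (y∉ ∷ xs!) (there x∈) f≈ε =
      trans (∙-cong (f≈ε (All.lookup y∉ x∈)) (⨁-single xs! x∈ f≈ε)) (identityˡ _)

    -- On a duplicate-free list of all elements, an injective self-map merely permutes the list:
    -- surjectivity follows from the equal lengths.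
    ⨁-reindex : ∀ {xs : List A} {g : A → A} → Unique xs → (∀ x → x ∈ xs) →
                (∀ {x y} → g x ≡ g y → x ≡ y) → ∀ f → ⨁ xs (λ x → f (g x)) ≈ ⨁ xs f
    ⨁-reindex {xs} {g} xs! all∈ inj f = begin
      foldr _∙_ ε (map (λ x → f (g x)) xs)  ≡⟨ ≡.cong (foldr _∙_ ε) (map-∘ xs) ⟩
      foldr _∙_ ε (map f (map g xs))        ≈⟨ ↭ₛ.foldr-commMonoid setoid isCommutativeMonoid
                                                 (↭⇒↭ₛ′ isEquivalence (map⁺ f gxs↭xs)) ⟩
      foldr _∙_ ε (map f xs)                ∎
      where
      gxs↭xs : map g xs ↭ xs
      gxs↭xs = unique⊆⇒↭ (Uniq.map⁺ inj xs!) (λ _ → all∈ _) (length-map g xs)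

    ⨁-++ : ∀ (xs ys : List A) f → ⨁ (xs ++ ys) f ≈ ⨁ xs f ∙ ⨁ ys f
    ⨁-++ []       ys f = sym (identityˡ _)
    ⨁-++ (x ∷ xs) ys f = trans (∙-congˡ (⨁-++ xs ys f)) (sym (assoc _ _ _))

  ⨁-swap : ∀ {a b} {A : Set a} {B : Set b} (xs : List A) (ys : List B) (f : A → B → Carrier) →
           ⨁ xs (λ x → ⨁ ys (f x)) ≈ ⨁ ys (λ y → ⨁ xs (λ x → f x y))
  ⨁-swap []       ys f = sym (⨁-ε ys (All.universal (λ _ → refl) ys))
  ⨁-swap (x ∷ xs) ys f = trans (∙-congˡ (⨁-swap xs ys f)) (sym (⨁-∙ ys (f x) _))

  ⨁-cartesianProduct : ∀ {a b} {A : Set a} {B : Set b} (xs : List A) (ys : List B) f →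
    ⨁ (cartesianProduct xs ys) f ≈ ⨁ xs (λ x → ⨁ ys (λ y → f (x , y)))
  ⨁-cartesianProduct []       ys f = refl
  ⨁-cartesianProduct (x ∷ xs) ys f = trans (⨁-++ (map (x ,_) ys) _ f)
    (∙-cong (reflexive (≡.cong (foldr _∙_ ε) (≡.sym (map-∘ ys)))) (⨁-cartesianProduct xs ys f))

concatMap≡cartesianProduct : ∀ {a b} {A : Set a} {B : Set b} (xs : List A) (ys : List B) →
  concatMap (λ x → map (x ,_) ys) xs ≡ cartesianProduct xs ys
concatMap≡cartesianProduct []       ys = ≡.refl
concatMap≡cartesianProduct (x ∷ xs) ys = ≡.cong (map (x ,_) ys ++_) (concatMap≡cartesianProduct xs ys)

open ≡ using (refl; sym; trans; cong; cong₂; subst; isEquivalence; module ≡-Reasoning)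

-- The ring of residues modulo p

module ModularArithmetic (p : ℕ) .{{_ : NonZero p}} where
  open Fp p
  open ≡-Reasoning

  toℕ-fromℕ : ∀ m → toℕ (fromℕ m) ≡ m % p
  toℕ-fromℕ m = toℕ-fromℕ< _

  fromℕ-cong : ∀ {m n} → m % p ≡ n % p → fromℕ m ≡ fromℕ n
  fromℕ-cong {m} {n} eq = fromℕ<-cong (m % p) (n % p) eq _ _

  fromℕ-injective : ∀ {m n} → fromℕ m ≡ fromℕ n → m % p ≡ n % p
  fromℕ-injective {m} {n} eq = trans (sym (toℕ-fromℕ m)) (trans (cong toℕ eq) (toℕ-fromℕ n))

  fromℕ-toℕ : ∀ a → fromℕ (toℕ a) ≡ a
  fromℕ-toℕ a = toℕ-injective (trans (toℕ-fromℕ (toℕ a)) (m<n⇒m%n≡m (toℕ<n a)))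

  -- With `fromℕ-*` this makes `fromℕ` a homomorphism; since `fromℕ-toℕ` makes it onto, the ring
  -- laws descend from ℕ.
  fromℕ-+ : ∀ m n → fromℕ (m ℕ.+ n) ≡ fromℕ m +F fromℕ n
  fromℕ-+ m n = fromℕ-cong (begin
    (m ℕ.+ n) % p                                ≡⟨ %-distribˡ-+ m n p ⟩
    (m % p ℕ.+ n % p) % p                        ≡⟨ cong₂ (λ x y → (x ℕ.+ y) % p) (toℕ-fromℕ m) (toℕ-fromℕ n) ⟨
    (toℕ (fromℕ m) ℕ.+ toℕ (fromℕ n)) % p        ∎)

  fromℕ-* : ∀ m n → fromℕ (m ℕ.* n) ≡ fromℕ m *F fromℕ n
  fromℕ-* m n = fromℕ-cong (begin
    (m ℕ.* n) % p                                ≡⟨ %-distribˡ-* m n p ⟩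
    (m % p ℕ.* (n % p)) % p                      ≡⟨ cong₂ (λ x y → (x ℕ.* y) % p) (toℕ-fromℕ m) (toℕ-fromℕ n) ⟨
    (toℕ (fromℕ m) ℕ.* toℕ (fromℕ n)) % p        ∎)

  +F-assoc : ∀ a b c → (a +F b) +F c ≡ a +F (b +F c)
  +F-assoc a b c = begin
    fromℕ (A ℕ.+ B) +F c              ≡⟨ cong (fromℕ (A ℕ.+ B) +F_) (fromℕ-toℕ c) ⟨
    fromℕ (A ℕ.+ B) +F fromℕ C        ≡⟨ fromℕ-+ (A ℕ.+ B) C ⟨
    fromℕ ((A ℕ.+ B) ℕ.+ C)           ≡⟨ cong fromℕ (ℕₚ.+-assoc A B C) ⟩
    fromℕ (A ℕ.+ (B ℕ.+ C))           ≡⟨ fromℕ-+ A (B ℕ.+ C) ⟩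
    fromℕ A +F (b +F c)               ≡⟨ cong (_+F (b +F c)) (fromℕ-toℕ a) ⟩
    a +F (b +F c)                     ∎
    where A = toℕ a ; B = toℕ b ; C = toℕ c

  *F-assoc : ∀ a b c → (a *F b) *F c ≡ a *F (b *F c)
  *F-assoc a b c = begin
    fromℕ (A ℕ.* B) *F c              ≡⟨ cong (fromℕ (A ℕ.* B) *F_) (fromℕ-toℕ c) ⟨
    fromℕ (A ℕ.* B) *F fromℕ C        ≡⟨ fromℕ-* (A ℕ.* B) C ⟨
    fromℕ ((A ℕ.* B) ℕ.* C)           ≡⟨ cong fromℕ (ℕₚ.*-assoc A B C) ⟩
    fromℕ (A ℕ.* (B ℕ.* C))           ≡⟨ fromℕ-* A (B ℕ.* C) ⟩
    fromℕ A *F (b *F c)               ≡⟨ cong (_*F (b *F c)) (fromℕ-toℕ a) ⟩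
    a *F (b *F c)                     ∎
    where A = toℕ a ; B = toℕ b ; C = toℕ c

  +F-comm : ∀ a b → a +F b ≡ b +F a
  +F-comm a b = cong fromℕ (ℕₚ.+-comm (toℕ a) (toℕ b))

  *F-comm : ∀ a b → a *F b ≡ b *F a
  *F-comm a b = cong fromℕ (ℕₚ.*-comm (toℕ a) (toℕ b))

  +F-identityˡ : ∀ a → 0F +F a ≡ a
  +F-identityˡ a = begin
    fromℕ 0 +F a              ≡⟨ cong (0F +F_) (fromℕ-toℕ a) ⟨
    fromℕ 0 +F fromℕ (toℕ a)  ≡⟨ fromℕ-+ 0 (toℕ a) ⟨
    fromℕ (toℕ a)             ≡⟨ fromℕ-toℕ a ⟩
    a                         ∎

  *F-identityˡ : ∀ a → fromℕ 1 *F a ≡ a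
  *F-identityˡ a = begin
    fromℕ 1 *F a              ≡⟨ cong (fromℕ 1 *F_) (fromℕ-toℕ a) ⟨
    fromℕ 1 *F fromℕ (toℕ a)  ≡⟨ fromℕ-* 1 (toℕ a) ⟨
    fromℕ (1 ℕ.* toℕ a)       ≡⟨ cong fromℕ (ℕₚ.*-identityˡ (toℕ a)) ⟩
    fromℕ (toℕ a)             ≡⟨ fromℕ-toℕ a ⟩
    a                         ∎

  -F-inverseʳ : ∀ a → a +F (-F a) ≡ 0F
  -F-inverseʳ a = begin
    a +F (-F a)                        ≡⟨ cong (_+F (-F a)) (fromℕ-toℕ a) ⟨
    fromℕ (toℕ a) +F fromℕ (p ∸ toℕ a) ≡⟨ fromℕ-+ (toℕ a) (p ∸ toℕ a) ⟨
    fromℕ (toℕ a ℕ.+ (p ∸ toℕ a))      ≡⟨ cong fromℕ (ℕₚ.m+[n∸m]≡n (ℕₚ.<⇒≤ (toℕ<n a))) ⟩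
    fromℕ p                            ≡⟨ fromℕ-cong (trans (n%n≡0 p) (sym (m<n⇒m%n≡m (ℕ.>-nonZero⁻¹ p)))) ⟩
    0F                                 ∎

  *F-distribˡ-+F : ∀ a b c → a *F (b +F c) ≡ (a *F b) +F (a *F c)
  *F-distribˡ-+F a b c = begin
    a *F (b +F c)                     ≡⟨ cong (_*F (b +F c)) (fromℕ-toℕ a) ⟨
    fromℕ A *F fromℕ (B ℕ.+ C)        ≡⟨ fromℕ-* A (B ℕ.+ C) ⟨
    fromℕ (A ℕ.* (B ℕ.+ C))           ≡⟨ cong fromℕ (ℕₚ.*-distribˡ-+ A B C) ⟩
    fromℕ (A ℕ.* B ℕ.+ A ℕ.* C)       ≡⟨ fromℕ-+ (A ℕ.* B) (A ℕ.* C) ⟩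
    (a *F b) +F (a *F c)              ∎
    where A = toℕ a ; B = toℕ b ; C = toℕ c

  F-isCommutativeRing : IsCommutativeRing _≡_ _+F_ _*F_ (-F_) 0F (fromℕ 1)
  F-isCommutativeRing = record
    { isRing = record
      { +-isAbelianGroup = record
        { isGroup = record
          { isMonoid = record
            { isSemigroup = record
              { isMagma = record { isEquivalence = isEquivalence ; ∙-cong = cong₂ _+F_ }
              ; assoc   = +F-assoc
              }
            ; identity = +F-identityˡ , λ a → trans (+F-comm a 0F) (+F-identityˡ a)
            }
          ; inverse = (λ a → trans (+F-comm (-F a) a) (-F-inverseʳ a)) , -F-inverseʳ
          ; ⁻¹-cong = cong (-F_)
          }
        ; comm = +F-comm
        }
      ; *-cong     = cong₂ _*F_
      ; *-assoc    = *F-assoc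
      ; *-identity = *F-identityˡ , λ a → trans (*F-comm a (fromℕ 1)) (*F-identityˡ a)
      ; distrib    = *F-distribˡ-+F , λ a b c → trans (*F-comm (b +F c) a)
                       (trans (*F-distribˡ-+F a b c) (cong₂ _+F_ (*F-comm a b) (*F-comm a c)))
      }
    ; *-comm = *F-comm
    }

  F-commutativeRing : CommutativeRing 0ℓ 0ℓ
  F-commutativeRing = record { isCommutativeRing = F-isCommutativeRing }

-- The prime field: cancellation, Fermat's theorem, inverses

module PrimeField (p : ℕ) .{{_ : NonZero p}} (p-prime : Prime p) where
  open Fp p
  open ModularArithmetic p
  open CommutativeRing F-commutativeRing using (*-commutativeMonoid; *-identityʳ; zeroʳ)
  open RingIdentities F-commutativeRing
  open import Algebra.Properties.Group (CommutativeRing.+-group F-commutativeRing) using (x∙y⁻¹≈ε⇒x≈y)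
  open BigOperator *-commutativeMonoid renaming (⨁ to ∏)
  open ≡-Reasoning

  1<p : 1 ℕ.< p
  1<p = ℕ.nonTrivial⇒n>1 p {{prime⇒nonTrivial p-prime}}

  fromℕ≡0⇒p∣ : ∀ {m} → fromℕ m ≡ 0F → p ∣ m
  fromℕ≡0⇒p∣ {m} eq = m%n≡0⇒n∣m m p (trans (fromℕ-injective eq) (m<n⇒m%n≡m (ℕ.>-nonZero⁻¹ p)))

  p∣⇒fromℕ≡0 : ∀ {m} → p ∣ m → fromℕ m ≡ 0F
  p∣⇒fromℕ≡0 {m} p∣m = fromℕ-cong (trans (n∣m⇒m%n≡0 m p p∣m) (sym (m<n⇒m%n≡m (ℕ.>-nonZero⁻¹ p))))

  fromℕ≢0 : ∀ {m} .{{_ : NonZero m}} → m ℕ.< p → fromℕ m ≢ 0F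
  fromℕ≢0 m<p eq = ℕₚ.<⇒≱ m<p (∣⇒≤ (fromℕ≡0⇒p∣ eq))

  *F-zero-divisors : ∀ {a b} → a *F b ≡ 0F → a ≡ 0F ⊎ b ≡ 0F
  *F-zero-divisors {a} {b} ab≡0 with euclidsLemma (toℕ a) (toℕ b) p-prime (fromℕ≡0⇒p∣ ab≡0)
  ... | inj₁ p∣a = inj₁ (trans (sym (fromℕ-toℕ a)) (p∣⇒fromℕ≡0 p∣a))
  ... | inj₂ p∣b = inj₂ (trans (sym (fromℕ-toℕ b)) (p∣⇒fromℕ≡0 p∣b))

  *F-cancelˡ : ∀ {a b c} → a ≢ 0F → a *F b ≡ a *F c → b ≡ c
  *F-cancelˡ {a} {b} {c} a≢0 ab≡ac =
    [ (λ a≡0 → ⊥-elim (a≢0 a≡0)) , x∙y⁻¹≈ε⇒x≈y b c ]′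
    (*F-zero-divisors {a} {b -F c} (xy≈xz⇒x[y-z]≈0 a b c ab≡ac))

  *F-nonZero : ∀ {a b} → a ≢ 0F → b ≢ 0F → a *F b ≢ 0F
  *F-nonZero {a} {b} a≢0 b≢0 ab≡0 = [ a≢0 , b≢0 ]′ (*F-zero-divisors {a} {b} ab≡0)

  private
    ifZero : F → F → F → F
    ifZero x y z with x ≟ 0F
    ... | yes _ = y
    ... | no  _ = z

    ifZero-zero : ∀ {y z} → ifZero 0F y z ≡ y
    ifZero-zero with 0F ≟ 0F
    ... | yes _  = refl
    ... | no 0≢0 = ⊥-elim (0≢0 refl)

    ifZero-nonZero : ∀ {x y z} → x ≢ 0F → ifZero x y z ≡ z
    ifZero-nonZero {x} x≢0 with x ≟ 0F
    ... | yes x≡0 = ⊥-elim (x≢0 x≡0)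
    ... | no _    = refl

    orOne : F → F
    orOne x = ifZero x (fromℕ 1) x

    orOne≢0 : ∀ x → orOne x ≢ 0F
    orOne≢0 x with x ≟ 0F
    ... | yes _  = fromℕ≢0 1<p
    ... | no x≢0 = x≢0

    ∏-orOne≢0 : ∀ xs → ∏ xs orOne ≢ 0F
    ∏-orOne≢0 []       = fromℕ≢0 1<p
    ∏-orOne≢0 (x ∷ xs) = *F-nonZero (orOne≢0 x) (∏-orOne≢0 xs)

    ∏-const : ∀ a (xs : List F) → ∏ xs (λ _ → a) ≡ a ^F length xs
    ∏-const a []       = refl
    ∏-const a (_ ∷ xs) = cong (a *F_) (∏-const a xs)

    -- The second factor repairs x = 0, where `orOne (a *F x)` is 1 but the right side is a. Over
    -- all x these corrections multiply to a single a, which is why Fermat's theorem comes out as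
    -- a^p = a.
    orOne-scale : ∀ {a} → a ≢ 0F → ∀ x → orOne (a *F x) *F ifZero x a (fromℕ 1) ≡ a *F orOne x
    orOne-scale {a} a≢0 x with x ≟ 0F
    ... | yes refl = trans (cong₂ _*F_ (trans (cong orOne (zeroʳ a)) ifZero-zero) refl) (*F-comm (fromℕ 1) a)
    ... | no x≢0   = trans (*-identityʳ _) (ifZero-nonZero (*F-nonZero a≢0 x≢0))

  -- Multiplication by a permutes the nonzero elements; orOne keeps the product over all of F nonzero.
  fermat : ∀ {a} → a ≢ 0F → a ^F p ≡ a
  fermat {a} a≢0 = *F-cancelˡ (∏-orOne≢0 Fs) (begin
    P *F (a ^F p)                                        ≡⟨ *F-comm P (a ^F p) ⟩
    (a ^F p) *F P                                        ≡⟨ cong (λ k → (a ^F k) *F P) (length-tabulate {n = p} id) ⟨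
    (a ^F length Fs) *F P                                ≡⟨ cong (_*F P) (∏-const a Fs) ⟨
    ∏ Fs (λ _ → a) *F P                                  ≡⟨ ⨁-∙ Fs (λ _ → a) orOne ⟨
    ∏ Fs (λ x → a *F orOne x)                            ≡⟨ ⨁-cong Fs (orOne-scale a≢0) ⟨
    ∏ Fs (λ x → orOne (a *F x) *F ifZero x a (fromℕ 1))  ≡⟨ ⨁-∙ Fs (λ x → orOne (a *F x)) _ ⟩
    ∏ Fs (λ x → orOne (a *F x)) *F ∏ Fs (λ x → ifZero x a (fromℕ 1))
      ≡⟨ cong₂ _*F_ (⨁-reindex Fs! ∈-allFin (*F-cancelˡ a≢0) orOne)
                    (trans (⨁-single Fs! (∈-allFin 0F) ifZero-nonZero) ifZero-zero) ⟩
    P *F a                                               ∎)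
    where
    Fs = allFin p
    Fs! = Uniq.allFin⁺ p
    P = ∏ Fs orOne

  -- One more factor a turns the claim into a^p = a; `p ∸ 2` is an exact difference because p > 1.
  *F-invF : ∀ {a} → a ≢ 0F → a *F invF a ≡ fromℕ 1
  *F-invF {a} a≢0 = *F-cancelˡ a≢0 (begin
    a *F (a *F (a ^F (p ∸ 2)))   ≡⟨⟩
    a ^F (2 ℕ.+ (p ∸ 2))         ≡⟨ cong (a ^F_) (ℕₚ.m+[n∸m]≡n 1<p) ⟩
    a ^F p                       ≡⟨ fermat a≢0 ⟩
    a                            ≡⟨ *-identityʳ a ⟨
    a *F fromℕ 1                 ∎)

-- Sums of two squares for p ≡ 3 (mod 4)

module PrimeField≡3mod4 (p : ℕ) .{{_ : NonZero p}} (p-prime : Prime p) (p%4≡3 : p % 4 ≡ 3) where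
  open Fp p
  open ModularArithmetic p
  open PrimeField p p-prime
  open CommutativeRing F-commutativeRing using (zeroˡ)
  open RingIdentities F-commutativeRing
  open import Algebra.Properties.Group (CommutativeRing.+-group F-commutativeRing) using (x∙y⁻¹≈ε⇒x≈y; ⁻¹-injective; ∙-cancelˡ)

  q : ℕ
  q = p ℕ./ 4

  p≡3+4q : p ≡ 3 ℕ.+ q ℕ.* 4
  p≡3+4q = trans (m≡m%n+[m/n]*n p 4) (cong (ℕ._+ q ℕ.* 4) p%4≡3)

  2<p : 2 ℕ.< p
  2<p = subst (2 ℕ.<_) (sym p≡3+4q) (ℕ.s≤s (ℕ.s≤s (ℕ.s≤s ℕ.z≤n)))

  -- Written as a sum to match the solver's image of the integer 2; `fromℕ4` links it to the 4 in
  -- the statement.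
  2F : F
  2F = fromℕ 1 +F fromℕ 1

  2F≢0 : 2F ≢ 0F
  2F≢0 eq = fromℕ≢0 2<p (trans (fromℕ-+ 1 1) eq)

  fromℕ4 : fromℕ 4 ≡ 2F *F 2F
  fromℕ4 = trans (fromℕ-* 2 2) (cong₂ _*F_ (fromℕ-+ 1 1) (fromℕ-+ 1 1))

  -- Applied at n = q it writes a^p as a cube times a power of a⁴, the one part that is shared by u
  -- and v when u² + v² = 0.
  ^F-3+4n : ∀ a n → a ^F (3 ℕ.+ n ℕ.* 4) ≡ (a *F (a *F a)) *F (((a *F a) *F (a *F a)) ^F n)
  ^F-3+4n a zero    = trans (cong (a *F_) (sym (*F-assoc a a (fromℕ 1)))) (sym (*F-assoc a (a *F a) (fromℕ 1)))
  ^F-3+4n a (suc n) = trans (cong (λ x → a *F (a *F (a *F (a *F x)))) (^F-3+4n a n)) (x⁴[x³y]≈x³[x⁴y] a _)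

  sum-of-squares≡0 : ∀ {u v} → (u *F u) +F (v *F v) ≡ 0F → u ≡ 0F × v ≡ 0F
  sum-of-squares≡0 {u} {v} eq with u ≟ 0F | v ≟ 0F
  ... | yes u≡0 | yes v≡0 = u≡0 , v≡0
  ... | yes refl | no v≢0 = ⊥-elim (*F-nonZero v≢0 v≢0
        (trans (sym (+F-identityˡ _)) (trans (cong (_+F (v *F v)) (sym (zeroˡ 0F))) eq)))
  ... | no u≢0 | yes refl = ⊥-elim (*F-nonZero u≢0 u≢0
        (trans (sym (+F-identityˡ _)) (trans (+F-comm 0F _) (trans (cong ((u *F u) +F_) (sym (zeroˡ 0F))) eq))))
  -- Fermat's theorem for u is rewritten with v⁴ in place of u⁴, so that one `X` serves both; then
  -- 2uv = 0 contradicts p being odd.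
  ... | no u≢0 | no v≢0 = ⊥-elim (*F-nonZero 2F≢0 (*F-nonZero u≢0 v≢0) (cubes⇒2xy≈0 u v (((v *F v) *F (v *F v)) ^F q) eq
        (trans (cong (λ x → (u *F (u *F u)) *F (x ^F q)) (sym (x²+y²≈0⇒x⁴≈y⁴ u v eq))) (fermat′ u≢0)) (fermat′ v≢0)))
    where
    fermat′ : ∀ {a} → a ≢ 0F → (a *F (a *F a)) *F (((a *F a) *F (a *F a)) ^F q) ≡ a
    fermat′ {a} a≢0 = trans (sym (^F-3+4n a q)) (trans (cong (a ^F_) (sym p≡3+4q)) (fermat a≢0))

  square-roots : ∀ x y → x *F x ≡ y *F y → x ≡ y ⊎ x +F y ≡ 0F
  square-roots x y eq = Sum.map₁ (x∙y⁻¹≈ε⇒x≈y x y)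
    (*F-zero-divisors {x -F y} {x +F y} (x²≈y²⇒[x-y][x+y]≈0 x y eq))

  -- This is (p - 1)/2, because p = 4q + 3.
  half : ℕ
  half = suc (q ℕ.* 2)

  p≡1+2half : p ≡ suc (half ℕ.+ half)
  p≡1+2half = trans p≡3+4q (cong (2 ℕ.+_) (trans (cong suc lemma) (sym (ℕₚ.+-suc (q ℕ.* 2) (q ℕ.* 2)))))
    where
    lemma : q ℕ.* 4 ≡ q ℕ.* 2 ℕ.+ q ℕ.* 2
    lemma = ℕₚ.*-distribˡ-+ q 2 2

  -- The residues 0, ..., (p - 1)/2 contain exactly one of each pair x, -x.
  root : Fin (suc half) → F
  root x = fromℕ (toℕ x)

  2half<p : ∀ {m n} → m ℕ.≤ half → n ℕ.≤ half → m ℕ.+ n ℕ.< p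
  2half<p m≤ n≤ = subst (_ ℕ.<_) (sym p≡1+2half) (ℕ.s≤s (ℕₚ.+-mono-≤ m≤ n≤))

  -- Equal squares mean x = y or x + y = 0 in the field. Two representatives add up to at most p -
  -- 1, so the latter forces both to be 0.
  root-square-injective : ∀ x y → root x *F root x ≡ root y *F root y → x ≡ y
  root-square-injective x y eq = toℕ-injective ([ same , opposite ]′ (square-roots (root x) (root y) eq))
    where
    X≤ : toℕ x ℕ.≤ half
    X≤ = toℕ≤pred[n] x
    Y≤ : toℕ y ℕ.≤ half
    Y≤ = toℕ≤pred[n] y
    <p : ∀ {m} → m ℕ.≤ half → m ℕ.< p
    <p m≤ = ℕₚ.≤-<-trans (ℕₚ.m≤m+n _ half) (2half<p m≤ ℕₚ.≤-refl)
    same : root x ≡ root y → toℕ x ≡ toℕ y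
    same e = trans (sym (m<n⇒m%n≡m (<p X≤))) (trans (fromℕ-injective e) (m<n⇒m%n≡m (<p Y≤)))
    opposite : root x +F root y ≡ 0F → toℕ x ≡ toℕ y
    opposite e = trans (ℕₚ.m+n≡0⇒m≡0 (toℕ x) sum≡0) (sym (ℕₚ.m+n≡0⇒n≡0 (toℕ x) sum≡0))
      where
      sum≡0 : toℕ x ℕ.+ toℕ y ≡ 0
      sum≡0 = trans (sym (m<n⇒m%n≡m (2half<p X≤ Y≤)))
                    (n∣m⇒m%n≡0 _ p (fromℕ≡0⇒p∣ (trans (fromℕ-+ (toℕ x) (toℕ y)) e)))

  -- The (p+1)/2 squares and the (p+1)/2 values K - v² cannot be disjoint.
  Q-surjective : ∀ K → ∃ λ z → Q z ≡ K
  Q-surjective K = decide x≢y gx≡gy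
    where
    g : Fin (suc half) ⊎ Fin (suc half) → F
    g (inj₁ u) = root u *F root u
    g (inj₂ v) = K -F (root v *F root v)

    collision : ∃ λ x → ∃ λ y → x Fin.< y × g (splitAt (suc half) x) ≡ g (splitAt (suc half) y)
    collision = pigeonhole (ℕₚ.≤-reflexive (cong suc (trans p≡1+2half (sym (ℕₚ.+-suc half half))))) (g ∘ splitAt (suc half))

    gx≡gy = proj₂ (proj₂ (proj₂ collision))
    x≢y : splitAt (suc half) (proj₁ collision) ≢ splitAt (suc half) (proj₁ (proj₂ collision))
    x≢y e = Finₚ.<⇒≢ (proj₁ (proj₂ (proj₂ collision)))
      (trans (sym (join-splitAt (suc half) (suc half) _))
        (trans (cong (join (suc half) (suc half)) e) (join-splitAt (suc half) (suc half) _)))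

    -- Within one family injectivity rules a collision out; across the families it reads u² = K -
    -- v².
    decide : ∀ {s t} → s ≢ t → g s ≡ g t → ∃ λ z → Q z ≡ K
    decide {inj₁ u} {inj₁ v} s≢t e = ⊥-elim (s≢t (cong inj₁ (root-square-injective u v e)))
    decide {inj₁ u} {inj₂ v} s≢t e = (root u , root v) , x≈y-z⇒x+z≈y (root u *F root u) K (root v *F root v) e
    decide {inj₂ u} {inj₁ v} s≢t e = (root v , root u) , x≈y-z⇒x+z≈y (root v *F root v) K (root u *F root u) (sym e)
    decide {inj₂ u} {inj₂ v} s≢t e = ⊥-elim (s≢t (cong inj₂ (root-square-injective u v
      (⁻¹-injective {root u *F root u} {root v *F root v} (∙-cancelˡ K (-F (root u *F root u)) (-F (root v *F root v)) e)))))

-- Sizes of the circles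

open BigOperator ℕₚ.+-0-commutativeMonoid renaming (⨁ to ∑)

sum-*ʳ : ∀ {a} {A : Set a} (xs : List A) f c → ∑ xs (λ x → f x ℕ.* c) ≡ ∑ xs f ℕ.* c
sum-*ʳ []       f c = refl
sum-*ʳ (x ∷ xs) f c = trans (cong (f x ℕ.* c ℕ.+_) (sum-*ʳ xs f c)) (sym (ℕₚ.*-distribʳ-+ c (f x) _))

sum-const : ∀ {a} {A : Set a} (xs : List A) c → ∑ xs (λ _ → c) ≡ length xs ℕ.* c
sum-const []       c = refl
sum-const (x ∷ xs) c = cong (c ℕ.+_) (sum-const xs c)

module Circles (p : ℕ) .{{_ : NonZero p}} (p-prime : Prime p) (p%4≡3 : p % 4 ≡ 3) where
  open Fp p
  open ModularArithmetic p
  open PrimeField p p-prime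
  open PrimeField≡3mod4 p p-prime p%4≡3
  open CommutativeRing F-commutativeRing using (*-identityʳ; zeroˡ)
  open RingIdentities F-commutativeRing
  open import Algebra.Properties.Group (CommutativeRing.+-group F-commutativeRing) using (inverseˡ-unique)
  open ≡-Reasoning

  Fs : List F
  Fs = allFin p

  Fs! : Unique Fs
  Fs! = Uniq.allFin⁺ p

  length-Fs : length Fs ≡ p
  length-Fs = length-tabulate {n = p} id

  allPts≡cartesianProduct : allPts ≡ cartesianProduct Fs Fs
  allPts≡cartesianProduct = concatMap≡cartesianProduct Fs Fs

  allPts! : Unique allPts
  allPts! = subst Unique (sym allPts≡cartesianProduct) (Uniq.cartesianProduct⁺ Fs! Fs!)

  ∈-allPts : ∀ x → x ∈ allPts
  ∈-allPts (u , v) = subst ((u , v) ∈_) (sym allPts≡cartesianProduct) (∈-cartesianProduct⁺ (∈-allFin u) (∈-allFin v))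

  sum-allPts : ∀ f → ∑ allPts f ≡ ∑ Fs (λ u → ∑ Fs (λ v → f (u , v)))
  sum-allPts f = trans (cong (λ xs → ∑ xs f) allPts≡cartesianProduct) (⨁-cartesianProduct Fs Fs f)

  [∧] : ∀ x y → [ x ∧ y ] ≡ [ x ] ℕ.* [ y ]
  [∧] true  y = sym (ℕₚ.+-identityʳ _)
  [∧] false y = refl

  [yes] : ∀ {A : Set} (a? : Dec A) → A → [ does a? ] ≡ 1
  [yes] a? a = cong [_] (dec-true a? a)

  [no] : ∀ {A : Set} (a? : Dec A) → ¬ A → [ does a? ] ≡ 0
  [no] a? ¬a = cong [_] (dec-false a? ¬a)

  count-unique : ∀ {A : Set} {P : A → Set} {xs x} (P? : ∀ y → Dec (P y)) → Unique xs → x ∈ xs →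
                 P x → (∀ {y} → P y → y ≡ x) → ∑ xs (λ y → [ does (P? y) ]) ≡ 1
  count-unique {x = x} P? xs! x∈xs Px unique = trans
    (⨁-single xs! x∈xs (λ {y} y≢x → [no] (P? y) (λ Py → y≢x (unique Py))))
    ([yes] (P? x) Px)

  _·_ : Pt → Pt → Pt
  (a , b) · (c , d) = ((a *F c) -F (b *F d)) , ((a *F d) +F (b *F c))

  Q-· : ∀ z x → Q (z · x) ≡ Q z *F Q x
  Q-· (a , b) (c , d) = norm-* a b c d

  ·-injective : ∀ z → Q z ≢ 0F → ∀ {x y} → z · x ≡ z · y → x ≡ y
  ·-injective (a , b) Qz≢0 {c , d} {c′ , d′} eq = cong₂ _,_
    (*F-cancelˡ Qz≢0 (trans (conj-*-re a b c d) (trans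
      (cong (λ w → (a *F proj₁ w) +F (b *F proj₂ w)) eq) (sym (conj-*-re a b c′ d′)))))
    (*F-cancelˡ Qz≢0 (trans (conj-*-im a b c d) (trans
      (cong (λ w → (a *F proj₂ w) -F (b *F proj₁ w)) eq) (sym (conj-*-im a b c′ d′)))))

  sum-· : ∀ z → Q z ≢ 0F → ∀ f → ∑ allPts (λ x → f (z · x)) ≡ ∑ allPts f
  sum-· z Qz≢0 = ⨁-reindex {g = z ·_} allPts! ∈-allPts (·-injective z Qz≢0)

  card-0 : card 0F ≡ 1
  card-0 = count-unique (λ x → Q x ≟ 0F) allPts! (∈-allPts (0F , 0F))
    (trans (cong (λ x → x +F x) (zeroˡ 0F)) (+F-identityˡ 0F))
    (λ {x} Qx≡0 → let u≡0 , v≡0 = sum-of-squares≡0 {proj₁ x} {proj₂ x} Qx≡0 in cong₂ _,_ u≡0 v≡0)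

  -- If Q z = K, then Q (z x) = K exactly when Q x = 1, so reindexing by z turns one indicator sum
  -- into the other.
  card-nonZero : ∀ {K} → K ≢ 0F → card K ≡ card (fromℕ 1)
  card-nonZero {K} K≢0 with Q-surjective K
  ... | z , Qz≡K = trans (sym (sum-· z Qz≢0 (λ x → [ inC K x ])))
          (⨁-cong allPts (λ x → cong [_] (does-⇔ (mk⇔ (to x) (from x)) (Q (z · x) ≟ K) (Q x ≟ fromℕ 1))))
    where
    Qz≢0 : Q z ≢ 0F
    Qz≢0 e = K≢0 (trans (sym Qz≡K) e)
    to : ∀ x → Q (z · x) ≡ K → Q x ≡ fromℕ 1
    to x e = *F-cancelˡ Qz≢0 (trans (sym (Q-· z x)) (trans e (trans (sym Qz≡K) (sym (*-identityʳ (Q z))))))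
    from : ∀ x → Q x ≡ fromℕ 1 → Q (z · x) ≡ K
    from x e = trans (Q-· z x) (trans (cong (Q z *F_) e) (trans (*-identityʳ (Q z)) Qz≡K))

  -- Every point of the plane lies on exactly one circle.
  sum-card : ∑ Fs card ≡ p ℕ.* p
  sum-card = begin
    ∑ Fs (λ K → ∑ allPts (λ x → [ inC K x ]))    ≡⟨ ⨁-swap Fs allPts (λ K x → [ inC K x ]) ⟩
    ∑ allPts (λ x → ∑ Fs (λ K → [ inC K x ]))    ≡⟨ ⨁-cong allPts (λ x →
                                                      count-unique (λ K → Q x ≟ K) Fs! (∈-allFin (Q x)) refl sym) ⟩
    ∑ allPts (λ _ → 1)                           ≡⟨ sum-allPts (λ _ → 1) ⟩
    ∑ Fs (λ _ → ∑ Fs (λ _ → 1))                  ≡⟨ sum-const Fs _ ⟩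
    length Fs ℕ.* ∑ Fs (λ _ → 1)                 ≡⟨ cong₂ ℕ._*_ length-Fs (trans (sum-const Fs 1) (trans (ℕₚ.*-identityʳ _) length-Fs)) ⟩
    p ℕ.* p                                      ∎

  -- Both sides are arranged so that summing over K needs no subtraction.
  card-split : ∀ K → card K ℕ.+ [ does (K ≟ 0F) ] ℕ.* card (fromℕ 1) ≡ card (fromℕ 1) ℕ.+ [ does (K ≟ 0F) ]
  card-split K = by-cases (K ≟ 0F)
    where
    c = card (fromℕ 1)
    by-cases : (d : Dec (K ≡ 0F)) → card K ℕ.+ [ does d ] ℕ.* c ≡ c ℕ.+ [ does d ]
    by-cases (yes K≡0) = begin
      card K ℕ.+ (c ℕ.+ 0)  ≡⟨ cong₂ ℕ._+_ (trans (cong card K≡0) card-0) (ℕₚ.+-identityʳ c) ⟩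
      1 ℕ.+ c               ≡⟨ ℕₚ.+-comm 1 c ⟩
      c ℕ.+ 1               ∎
    by-cases (no K≢0) = cong (ℕ._+ 0) (card-nonZero K≢0)

  -- Summing `card-split` over K gives p² + c = pc + 1, that is (p - 1)(p + 1) = (p - 1) c.
  card-1 : card (fromℕ 1) ≡ suc p
  card-1 = solve-for-c p c 1<p (begin
    p ℕ.* p ℕ.+ c                                                       ≡⟨ cong₂ ℕ._+_ (sym sum-card) (sym δc) ⟩
    ∑ Fs card ℕ.+ ∑ Fs (λ K → δ K ℕ.* c)                                ≡⟨ ⨁-∙ Fs card (λ K → δ K ℕ.* c) ⟨
    ∑ Fs (λ K → card K ℕ.+ δ K ℕ.* c)                                   ≡⟨ ⨁-cong Fs card-split ⟩
    ∑ Fs (λ K → c ℕ.+ δ K)                                              ≡⟨ ⨁-∙ Fs (λ _ → c) δ ⟩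
    ∑ Fs (λ _ → c) ℕ.+ ∑ Fs δ                                           ≡⟨ cong₂ ℕ._+_ (trans (sum-const Fs c) (cong (ℕ._* c) length-Fs)) sum-δ ⟩
    p ℕ.* c ℕ.+ 1                                                       ∎)
    where
    c = card (fromℕ 1)
    δ : F → ℕ
    δ K = [ does (K ≟ 0F) ]
    sum-δ : ∑ Fs δ ≡ 1
    sum-δ = count-unique (λ K → K ≟ 0F) Fs! (∈-allFin 0F) refl id
    δc : ∑ Fs (λ K → δ K ℕ.* c) ≡ c
    δc = trans (sum-*ʳ Fs δ c) (trans (cong (ℕ._* c) sum-δ) (ℕₚ.*-identityˡ c))
    solve-for-c : ∀ p c → 1 ℕ.< p → p ℕ.* p ℕ.+ c ≡ p ℕ.* c ℕ.+ 1 → c ≡ suc p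
    -- For p = 1 the equation would hold for every c. Below, m is p - 1, and c + 1 is removed from
    -- both sides before m is cancelled.
    solve-for-c (suc zero)      c (ℕ.s≤s ()) eq
    solve-for-c (suc m@(suc _)) c _ eq = ℕₚ.*-cancelˡ-≡ c (2 ℕ.+ m) m (sym (ℕₚ.+-cancelˡ-≡ (suc c) _ _ (begin
      suc c ℕ.+ m ℕ.* (2 ℕ.+ m)            ≡⟨ solve 2 (λ m c → con 1 :+ c :+ m :* (con 2 :+ m) := (con 1 :+ m) :* (con 1 :+ m) :+ c) refl m c ⟩
      suc m ℕ.* suc m ℕ.+ c                ≡⟨ eq ⟩
      suc m ℕ.* c ℕ.+ 1                    ≡⟨ solve 2 (λ m c → (con 1 :+ m) :* c :+ con 1 := con 1 :+ c :+ m :* c) refl m c ⟩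
      suc c ℕ.+ m ℕ.* c                    ∎)))
      where open ℕSolver.+-*-Solver

  card≡1+p : ∀ {K} → K ≢ 0F → card K ≡ suc p
  card≡1+p K≢0 = trans (card-nonZero K≢0) card-1

  -- Counting square roots

  roots : F → ℕ
  roots V = ∑ Fs (λ y → [ does ((y *F y) ≟ V) ])

  roots-nonSquare : ∀ {V} → ¬ IsSquare V → roots V ≡ 0
  roots-nonSquare {V} ¬sq = ⨁-ε Fs (All.universal (λ y → [no] ((y *F y) ≟ V) (λ e → ¬sq (y , e))) Fs)

  roots-zero : roots 0F ≡ 1
  roots-zero = count-unique (λ y → (y *F y) ≟ 0F) Fs! (∈-allFin 0F) (zeroˡ 0F)
    (λ {y} e → [ id , id ]′ (*F-zero-divisors {y} {y} e))

  -- Since 2s ≠ 0, s and -s differ, so the indicator of y² = s² is the sum of two one-point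
  -- indicators.
  roots-square : ∀ s → (s *F s) ≢ 0F → roots (s *F s) ≡ 2
  roots-square s s²≢0 = begin
    ∑ Fs (λ y → [ does ((y *F y) ≟ (s *F s)) ])                      ≡⟨ ⨁-cong Fs split ⟩
    ∑ Fs (λ y → [ does (y ≟ s) ] ℕ.+ [ does (y ≟ (-F s)) ])          ≡⟨ ⨁-∙ Fs (λ y → [ does (y ≟ s) ]) _ ⟩
    ∑ Fs (λ y → [ does (y ≟ s) ]) ℕ.+ ∑ Fs (λ y → [ does (y ≟ (-F s)) ])
      ≡⟨ cong₂ ℕ._+_ (count-unique (_≟ s) Fs! (∈-allFin s) refl id)
                     (count-unique (_≟ (-F s)) Fs! (∈-allFin (-F s)) refl id) ⟩
    2                                                                ∎
    where
    s≢0 : s ≢ 0F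
    s≢0 e = s²≢0 (trans (cong (_*F s) e) (zeroˡ s))
    s≢-s : s ≢ -F s
    s≢-s e = *F-nonZero 2F≢0 s≢0 (trans (2x≈x+x s) (trans (cong (s +F_) e) (-F-inverseʳ s)))
    [-s]² : (-F s) *F (-F s) ≡ s *F s
    [-s]² = neg-square s
    split : ∀ y → [ does ((y *F y) ≟ (s *F s)) ] ≡ [ does (y ≟ s) ] ℕ.+ [ does (y ≟ (-F s)) ]
    split y = by-cases (y ≟ s) (y ≟ (-F s))
      where
      y²? = (y *F y) ≟ (s *F s)
      by-cases : (d : Dec (y ≡ s)) (d′ : Dec (y ≡ -F s)) → [ does y²? ] ≡ [ does d ] ℕ.+ [ does d′ ]
      by-cases (yes y≡s) (yes y≡-s) = ⊥-elim (s≢-s (trans (sym y≡s) y≡-s))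
      by-cases (yes y≡s) (no _)     = [yes] y²? (cong (λ x → x *F x) y≡s)
      by-cases (no _)    (yes y≡-s) = [yes] y²? (trans (cong (λ x → x *F x) y≡-s) [-s]²)
      by-cases (no y≢s)  (no y≢-s)  = [no] y²? (λ e →
        [ y≢s , (λ y+s≡0 → y≢-s (inverseˡ-unique y s y+s≡0)) ]′ (square-roots y s e))

  -- Counting pairs with prescribed sum

  conj : Pt → Pt
  conj (a , b) = a , (-F b)

  -- Four times this is Archimedes' function 4ij - (k - i - j)², in Euclidean geometry sixteen times
  -- the squared area of a triangle. For a, b and a + b of quadrances i, j, k it is the squared
  -- determinant of a and b.
  discriminant : F → F → F → F
  discriminant i j k = (i *F j) -F ((((k -F i) -F j) *F ((k -F i) -F j)) *F invF (fromℕ 4))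

  4*inv4 : (2F *F 2F) *F invF (fromℕ 4) ≡ fromℕ 1
  4*inv4 = trans (cong (_*F invF (fromℕ 4)) (sym fromℕ4))
                 (*F-invF (λ e → *F-nonZero 2F≢0 2F≢0 (trans (sym fromℕ4) e)))

  -- The count does not depend on the choice of a: after the substitution the two coordinates of w
  -- are constrained independently, so the sum factors as 1 times `roots V`.
  count-second : ∀ i j k a → i ≢ 0F → Q a ≡ i →
    ∑ allPts (λ b → [ inC j b ∧ inC k (a +P b) ]) ≡ roots (discriminant i j k)
  count-second i j k (a₁ , a₂) i≢0 Qa≡i = begin
    ∑ allPts (λ b → [ inC j b ∧ inC k (a +P b) ])                    ≡⟨ ⨁-cong allPts transform ⟩
    ∑ allPts (λ b → g (conj a · b))                                  ≡⟨ sum-· (conj a) Qā≢0 g ⟩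
    ∑ allPts g                                                       ≡⟨ sum-allPts g ⟩
    ∑ Fs (λ w₁ → ∑ Fs (λ w₂ → g (w₁ , w₂)))                          ≡⟨ ⨁-cong Fs inner ⟩
    ∑ Fs (λ w₁ → [ does (w₁ ≟ C) ] ℕ.* roots V)                      ≡⟨ sum-*ʳ Fs (λ w₁ → [ does (w₁ ≟ C) ]) (roots V) ⟩
    ∑ Fs (λ w₁ → [ does (w₁ ≟ C) ]) ℕ.* roots V                      ≡⟨ cong (ℕ._* roots V) (count-unique (_≟ C) Fs! (∈-allFin C) refl id) ⟩
    1 ℕ.* roots V                                                    ≡⟨ ℕₚ.*-identityˡ _ ⟩
    roots V                                                          ∎
    where
    a = a₁ , a₂
    open CirclePair i j k (invF (fromℕ 4)) a₁ a₂ 4*inv4 Qa≡i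
    g : Pt → ℕ
    g (w₁ , w₂) = [ does (w₁ ≟ C) ∧ does ((w₂ *F w₂) ≟ V) ]
    Qā≢0 : Q (conj a) ≢ 0F
    Qā≢0 e = i≢0 (trans (sym Qa≡i) (trans (sym (norm-conj a₁ a₂)) e))
    transform : ∀ b → [ inC j b ∧ inC k (a +P b) ] ≡ g (conj a · b)
    -- The `does` of a product decision is the conjunction of the Booleans, so a logical equivalence
    -- gives equal indicators.
    transform (c , d) = cong [_] (does-⇔ (mk⇔ to from)
        ((Q (c , d) ≟ j) ×-dec (Q (a +P (c , d)) ≟ k))
        ((re c d ≟ C) ×-dec ((im c d *F im c d) ≟ V)))
      where
      to : Q (c , d) ≡ j × Q (a +P (c , d)) ≡ k → re c d ≡ C × im c d *F im c d ≡ V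
      to (Qb≡j , Qab≡k) = re≡C , im²≈V c d Qb≡j re≡C
        where re≡C = re≈C c d Qb≡j Qab≡k
      from : re c d ≡ C × im c d *F im c d ≡ V → Q (c , d) ≡ j × Q (a +P (c , d)) ≡ k
      from (re≡C , im²≡V) = Qb≡j , norm-sum≈k c d Qb≡j re≡C
        where
        Qb≡j : Q (c , d) ≡ j
        Qb≡j = *F-cancelˡ i≢0 (i[c²+d²]≈ij c d re≡C im²≡V)
    inner : ∀ w₁ → ∑ Fs (λ w₂ → g (w₁ , w₂)) ≡ [ does (w₁ ≟ C) ] ℕ.* roots V
    inner w₁ = begin
      ∑ Fs (λ w₂ → [ does (w₁ ≟ C) ∧ does ((w₂ *F w₂) ≟ V) ])
        ≡⟨ ⨁-cong Fs (λ w₂ → trans ([∧] (does (w₁ ≟ C)) _) (ℕₚ.*-comm [ does (w₁ ≟ C) ] _)) ⟩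
      ∑ Fs (λ w₂ → [ does ((w₂ *F w₂) ≟ V) ] ℕ.* [ does (w₁ ≟ C) ])
        ≡⟨ sum-*ʳ Fs (λ w₂ → [ does ((w₂ *F w₂) ≟ V) ]) [ does (w₁ ≟ C) ] ⟩
      roots V ℕ.* [ does (w₁ ≟ C) ]
        ≡⟨ ℕₚ.*-comm (roots V) _ ⟩
      [ does (w₁ ≟ C) ] ℕ.* roots V ∎

  N≡card*roots : ∀ {i} j k → i ≢ 0F → N i j k ≡ card i ℕ.* roots (discriminant i j k)
  N≡card*roots {i} j k i≢0 = trans (⨁-cong allPts (λ a → by-cases a (Q a ≟ i)))
                                  (sum-*ʳ allPts (λ a → [ inC i a ]) (roots (discriminant i j k)))
    where
    -- With the decision as an argument, the indicator of C_i computes in each branch.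
    by-cases : ∀ a (d : Dec (Q a ≡ i)) →
      ∑ allPts (λ b → [ does d ∧ inC j b ∧ inC k (a +P b) ]) ≡ [ does d ] ℕ.* roots (discriminant i j k)
    by-cases a (yes Qa≡i) = trans (count-second i j k a i≢0 Qa≡i) (sym (ℕₚ.*-identityˡ _))
    by-cases a (no _)     = ⨁-ε allPts (All.universal (λ _ → refl) allPts)

  -- From counts to ratios

  n≡N/m : ∀ i j k m → card i ℕ.* card j ≡ suc m → n i j k ≡ (+ N i j k) / suc m
  n≡N/m i j k m eq with card i ℕ.* card j | eq
  ... | suc _ | refl = refl

  n≡r/[1+p] : ∀ {i j} k r → i ≢ 0F → j ≢ 0F → N i j k ≡ card i ℕ.* r → n i j k ≡ (+ r) / suc p
  n≡r/[1+p] {i} {j} k r i≢0 j≢0 N≡ = begin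
    -- The number p + p (p + 1) is the predecessor of (p + 1)², as `n≡N/m` expects.
    n i j k                                    ≡⟨ n≡N/m i j k (p ℕ.+ p ℕ.* suc p) (cong₂ ℕ._*_ (card≡1+p i≢0) (card≡1+p j≢0)) ⟩
    (+ N i j k) / (suc p ℕ.* suc p)            ≡⟨ cong (λ x → (+ x) / (suc p ℕ.* suc p)) (trans N≡ (cong (ℕ._* r) (card≡1+p i≢0))) ⟩
    -- `_/_` reduces to lowest terms, so the common factor p + 1 is removed by cross-multiplying
    -- unnormalised fractions.
    (+ (suc p ℕ.* r)) / (suc p ℕ.* suc p)      ≡⟨ ℚₚ.fromℚᵘ-cong {ℚᵘ.mkℚᵘ (+ (suc p ℕ.* r)) (p ℕ.+ p ℕ.* suc p)}
                                                                 {ℚᵘ.mkℚᵘ (+ r) p} (ℚᵘ.*≡* cross) ⟩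
    (+ r) / suc p                              ∎
    where
    cross : + (suc p ℕ.* r) ℤ.* + suc p ≡ + r ℤ.* + (suc p ℕ.* suc p)
    cross = begin
      + (suc p ℕ.* r) ℤ.* + suc p     ≡⟨ ℤₚ.pos-* (suc p ℕ.* r) (suc p) ⟨
      + (suc p ℕ.* r ℕ.* suc p)       ≡⟨ cong (λ x → + (x ℕ.* suc p)) (ℕₚ.*-comm (suc p) r) ⟩
      + (r ℕ.* suc p ℕ.* suc p)       ≡⟨ cong +_ (ℕₚ.*-assoc r (suc p) (suc p)) ⟩
      + (r ℕ.* (suc p ℕ.* suc p))     ≡⟨ ℤₚ.pos-* r (suc p ℕ.* suc p) ⟩
      + r ℤ.* + (suc p ℕ.* suc p)     ∎

theorem1 : (p : ℕ) .{{_ : NonZero p}} → Prime p → p % 4 ≡ 3 →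
  let open Fp p in
  (i j k : F) → i ≢ 0F → j ≢ 0F →
  let V = (i *F j) -F ((((k -F i) -F j) *F ((k -F i) -F j)) *F invF (fromℕ 4)) in
  (¬ IsSquare V → N i j k ≡ 0 × n i j k ≡ (+ 0) / 1)
  × (V ≡ 0F → N i j k ≡ card i × card i ≡ suc p × n i j k ≡ (+ 1) / suc p)
  × (IsSquare V → V ≢ 0F →
       N i j k ≡ 2 Data.Nat.* card i × card i ≡ suc p × n i j k ≡ (+ 2) / suc p)
theorem1 p p-prime p%4≡3 i j k i≢0 j≢0 = nonSquare , zeroCase , squareCase
  where
  open Fp p
  open Circles p p-prime p%4≡3

  N≡ : ∀ {r} → roots (discriminant i j k) ≡ r → N i j k ≡ card i ℕ.* r
  N≡ eq = trans (N≡card*roots j k i≢0) (cong (card i ℕ.*_) eq)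

  n≡ : ∀ {r} → roots (discriminant i j k) ≡ r → n i j k ≡ (+ r) / suc p
  n≡ {r} eq = n≡r/[1+p] k r i≢0 j≢0 (N≡ eq)

  nonSquare : ¬ IsSquare (discriminant i j k) → N i j k ≡ 0 × n i j k ≡ (+ 0) / 1
  nonSquare ¬sq = trans (N≡ #roots) (ℕₚ.*-zeroʳ (card i)) ,
    -- The general formula yields 0/(p + 1), while the statement has 0/1.
    trans (n≡ #roots) (ℚₚ.fromℚᵘ-cong {ℚᵘ.mkℚᵘ (+ 0) p} {ℚᵘ.mkℚᵘ (+ 0) 0} (ℚᵘ.*≡* refl))
    where #roots = roots-nonSquare ¬sq

  zeroCase : discriminant i j k ≡ 0F → N i j k ≡ card i × card i ≡ suc p × n i j k ≡ (+ 1) / suc p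
  zeroCase V≡0 = trans (N≡ #roots) (ℕₚ.*-identityʳ (card i)) , card≡1+p i≢0 , n≡ #roots
    where #roots = trans (cong roots V≡0) roots-zero

  squareCase : IsSquare (discriminant i j k) → discriminant i j k ≢ 0F →
    N i j k ≡ 2 ℕ.* card i × card i ≡ suc p × n i j k ≡ (+ 2) / suc p
  squareCase (s , s²≡V) V≢0 = trans (N≡ #roots) (ℕₚ.*-comm (card i) 2) , card≡1+p i≢0 , n≡ #roots
    where #roots = trans (cong roots (sym s²≡V)) (roots-square s (λ e → V≢0 (trans (sym s²≡V) e)))
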